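{- Let $S$ be an $\mathcal{EL}$-based proof system over $StExp(A)$ with $\mathsf{ACI}\sqsubseteq S\precsim\mathsf{Mil}$. Then provability by LLEE-witnessed coinductive proofs over $S$ implies derivability in $\mathsf{Mil}$: for all $e_1,e_2\in StExp(A)$, if $e_1\overset{\mathrm{LLEE}}{=}_S e_2$ then $e_1=_{\mathsf{Mil}}e_2$.
   Context: **Star expressions.** For a set $A$ of actions, the set $StExp(A)$ of star expressions is generated by $e ::= 0\mid 1\mid a\mid (e_1+e_2)\mid (e_1\cdot e_2)\mid e^*$ with $a\in A$. $\sum_{i=1}^n e_i$ is $0$ for $n=0$, $e_1$ for $n=1$, and $(\sum_{i=1}^{n-1}e_i)+e_n$ for $n>1$. $Eq(A)$ is the set of formal equations $e=f$ with $e,f\in StExp(A)$. Immediate termination $e{\downarrow}$ is defined inductively by: $1{\downarrow}$; $(e_1+e_2){\downarrow}$ if $e_1{\downarrow}$ or $e_2{\downarrow}$; $(e_1\cdot e_2){\downarrow}$ if $e_1{\downarrow}$ and $e_2{\downarrow}$; $(e^*){\downarrow}$ always. Write $e{\not\downarrow}$ if $e{\downarrow}$ does not hold. **Proof systems.** An $Eq(A)$-based proof system is a Hilbert-style proof system whose formulas are the equations in $Eq(A)$; $e=_S f$ means that $e=f$ is derivable in $S$ without assumptions (is a theorem of $S$). It is $\mathcal{EL}$-based if its rules include those of equational logic: reflexivity, symmetry, transitivity, and the context rule (from $e=f$ infer $C[e]=C[f]$ for one-hole star expression contexts $C$); it may have arbitrary further axioms and rules. $S_1\precsim S_2$ means that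 every theorem of $S_1$ is a theorem of $S_2$. $\mathsf{ACI}$ consists of the axioms $(e+f)+g=e+(f+g)$, $e+f=f+e$, $e+e=e$; $\mathsf{ACI}\sqsubseteq S$ means that all of these are axioms of $S$. $\mathsf{Mil}^-$ is the $\mathcal{EL}$-based system with exactly the rules of equational logic and the axiom schemes: $(e+f)+g=e+(f+g)$, $e+0=e$, $e+f=f+e$, $e+e=e$, $(e\cdot f)\cdot g=e\cdot(f\cdot g)$, $(e+f)\cdot g=e\cdot g+f\cdot g$, $1\cdot e=e$, $e\cdot 1=e$, $0\cdot e=0$, $e^*=1+e\cdot e^*$, $e^*=(1+e)^*$. Milner's system $\mathsf{Mil}$ is $\mathsf{Mil}^-$ extended by the rule $\mathrm{RSP}^*$: from $e=f\cdot e+g$ infer $e=f^*\cdot g$, provided $f{\not\downarrow}$. **1-charts and solutions.** A 1-chart is $C=\langle V,A,1,v_s,\to,\downarrow\rangle$ with a finite set $V$ of vertices, a set $A$ of (proper) action labels, an empty-step label $1\notin A$, a start vertex $v_s\in V$, a transition relation $\to\,\subseteq V\times(A\cup\{1\})\times V$, and a set $\downarrow\,\subseteq V$ of vertices with immediate termination. Transitions with label in $A$ are proper; those with label $1$ are 1-transitions. $C$ is weakly guarded if it has no cycle of 1-transitions. For an $\mathcal{EL}$-based system $S$ with $\mathsf{ACI}\sqsubseteq S$, a function $s:V\to StExp(A)$ is an $S$-provable solution of $C$ if for every $v\in V$: $s(v)=_S\tau_C(v)+\sum_{i=1}^n\underline a_i\cdot s(v_i)$, where $v\xrightarrow{\underline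 a_i}v_i$ ($1\le i\le n$, $\underline a_i\in A\cup\{1\}$) is a (possibly redundant) list of all transitions from $v$, and $\tau_C(v)$ is $1$ if $v{\downarrow}$ and $0$ otherwise. **Guarded LLEE-1-charts.** A loop 1-chart is a 1-chart such that (L1) there is an infinite path from the start vertex, (L2) every infinite path from the start vertex returns to it after a positive number of transitions, (L3) immediate termination is only permitted at the start vertex. Its transitions from the start vertex are its loop-entry transitions, all other transitions belong to its body. A loop sub-1-chart of $C$ is a loop 1-chart $L$ that is a sub-1-chart of $C$ with some vertex $v$ of $C$ as start vertex, formed, for a nonempty set $U$ of transitions of $C$ from $v$ (the loop-entry transitions of $L$), by all vertices and transitions on paths that start with a transition in $U$ and continue onward until $v$ is reached again. A multi-step loop elimination of loop sub-1-charts $L_1,\dots,L_n$ ($n\ge1$) from $C$, where their sets of loop-entry transitions are pairwise disjoint and no start vertex of one is in the body of another one, removes all loop-entry transitions of $L_1,\dots,L_n$, and then all vertices and transitions that become unreachable. A run (sequence of multi-steps) from $C$ is successful if it leads to a 1-chart without an infinite path; it is layered if it never removes loop-entry transitions that depart from a vertex in the body of a previously eliminated loop sub-1-chart. A LLEE-witness of $C$ is the labeling of the transitions of $C$ by natural numbers that records a successful layered run: marking label $n\ge1$ for transitions removed as loop-entry transitions in the $n$-th multi-step ('loop-entry transitions'), label $0$ for all other transitions ('body transitions'). It is guarded if all of its loop-entry transitions are proper. A guarded LLEE-1-chart is a 1-chart that has a guarded LLEE-witness. **Coinductive proofs.** Let $S$ be $\mathcal{EL}$-based with $\mathsf{ACI}\sqsubseteq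 S$. A coinductive proof over $S$ of $e_1=e_2$ is a pair $\langle C,L\rangle$ of a weakly guarded 1-chart $C$ with start vertex $v_s$ and a function $L:V(C)\to Eq(A)$, $v\mapsto (L_1(v)=L_2(v))$, such that $L_1$ and $L_2$ are $S$-provable solutions of $C$ and $L_1(v_s)\equiv e_1$, $L_2(v_s)\equiv e_2$ (syntactic equality). It is LLEE-witnessed if $C$ is a guarded LLEE-1-chart. $e_1\overset{\mathrm{LLEE}}{=}_S e_2$ means that there is a LLEE-witnessed coinductive proof over $S$ of $e_1=e_2$. -}

module Defs where

open import Data.Empty using (⊥)
open import Data.Fin using (Fin)
open import Data.Fin.Subset using (Subset; _∈_)
open import Data.Fin.Subset.Properties using (_∈?_)
open import Data.List using (List; []; _∷_; foldl; map)
open import Data.List.Membership.Propositional using () renaming (_∈_ to _∈ˡ_)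
open import Data.List.Relation.Unary.All using (All)
open import Data.Nat using (ℕ; zero; suc; _<_)
open import Data.Product using (Σ; ∃; ∃-syntax; _×_; _,_; proj₁; proj₂)
open import Data.Sum using (_⊎_; inj₁; inj₂)
open import Data.Unit using (⊤; tt)
open import Function using (_∘_)
open import Function.Bundles using (_⇔_)
open import Relation.Binary.Construct.Closure.ReflexiveTransitive
  using (Star; ε; _◅_; _◅◅_)
open import Relation.Binary.Construct.Closure.Transitive using (TransClosure)
open import Relation.Binary.PropositionalEquality using (_≡_; _≢_; refl)
open import Relation.Nullary using (¬_; yes; no)

private
  variable
    A : Set

------------------------------------------------------------------------
-- Star expressions

infixl 7 _⊕_
infixl 8 _·_
infixl 9 _⋆
infix  6 _↓

data StExp (A : Set) : Set where
  𝟎 𝟏 : StExp A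
  act : A → StExp A
  _⊕_ : StExp A → StExp A → StExp A
  _·_ : StExp A → StExp A → StExp A
  _⋆  : StExp A → StExp A

-- Left-associated, and without a summand 𝟎 unless the list is empty.
∑ : List (StExp A) → StExp A
∑ []       = 𝟎
∑ (e ∷ es) = foldl _⊕_ e es

data _↓ {A : Set} : StExp A → Set where
  𝟏↓  : 𝟏 ↓
  ⊕↓ˡ : ∀ {e f} → e ↓ → e ⊕ f ↓
  ⊕↓ʳ : ∀ {e f} → f ↓ → e ⊕ f ↓
  ·↓  : ∀ {e f} → e ↓ → f ↓ → e · f ↓
  ⋆↓  : ∀ {e} → e ⋆ ↓

infix 6 _≐_

record Equation (A : Set) : Set where
  constructor _≐_
  field
    lhs rhs : StExp A

open Equation public

data Context (A : Set) : Set where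
  □        : Context A
  _⊕ˡ_ _·ˡ_ : Context A → StExp A → Context A
  _⊕ʳ_ _·ʳ_ : StExp A → Context A → Context A
  _⋆ᶜ      : Context A → Context A

_[_] : Context A → StExp A → StExp A
□        [ e ] = e
(C ⊕ˡ f) [ e ] = C [ e ] ⊕ f
(C ·ˡ f) [ e ] = C [ e ] · f
(f ⊕ʳ C) [ e ] = f ⊕ C [ e ]
(f ·ʳ C) [ e ] = f · C [ e ]
(C ⋆ᶜ)   [ e ] = (C [ e ]) ⋆

------------------------------------------------------------------------
-- Proof systems

-- `Rule ps c` holds of the rule instances with premises `ps` and
-- conclusion `c`; the axioms are the instances without premises.
record ProofSystem (A : Set) : Set₁ where
  field
    Rule : List (Equation A) → Equation A → Set

open ProofSystem public

data Theorem (S : ProofSystem A) : Equation A → Set where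
  apply : ∀ {ps c} → Rule S ps c → All (Theorem S) ps → Theorem S c

infix 4 _=[_]_

_=[_]_ : StExp A → ProofSystem A → StExp A → Set
e =[ S ] f = Theorem S (e ≐ f)

data ELRule {A : Set} : List (Equation A) → Equation A → Set where
  reflexivity  : ∀ {e} → ELRule [] (e ≐ e)
  symmetry     : ∀ {e f} → ELRule (e ≐ f ∷ []) (f ≐ e)
  transitivity : ∀ {e f g} → ELRule (e ≐ f ∷ f ≐ g ∷ []) (e ≐ g)
  context      : ∀ {e f} (C : Context A) →
                 ELRule (e ≐ f ∷ []) (C [ e ] ≐ C [ f ])

data ACIAxiom {A : Set} : Equation A → Set where
  assoc⊕ : ∀ e f g → ACIAxiom ((e ⊕ f) ⊕ g ≐ e ⊕ (f ⊕ g))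
  comm⊕  : ∀ e f → ACIAxiom (e ⊕ f ≐ f ⊕ e)
  idem⊕  : ∀ e → ACIAxiom (e ⊕ e ≐ e)

data Mil⁻Axiom {A : Set} : Equation A → Set where
  aci      : ∀ {eq} → ACIAxiom eq → Mil⁻Axiom eq
  neutral⊕ : ∀ e → Mil⁻Axiom (e ⊕ 𝟎 ≐ e)
  assoc·   : ∀ e f g → Mil⁻Axiom ((e · f) · g ≐ e · (f · g))
  distribʳ : ∀ e f g → Mil⁻Axiom ((e ⊕ f) · g ≐ e · g ⊕ f · g)
  idˡ·     : ∀ e → Mil⁻Axiom (𝟏 · e ≐ e)
  idʳ·     : ∀ e → Mil⁻Axiom (e · 𝟏 ≐ e)
  zeroˡ    : ∀ e → Mil⁻Axiom (𝟎 · e ≐ 𝟎)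
  unfold⋆  : ∀ e → Mil⁻Axiom (e ⋆ ≐ 𝟏 ⊕ e · e ⋆)
  strip⋆   : ∀ e → Mil⁻Axiom (e ⋆ ≐ (𝟏 ⊕ e) ⋆)

data Mil⁻Rule {A : Set} : List (Equation A) → Equation A → Set where
  el    : ∀ {ps c} → ELRule ps c → Mil⁻Rule ps c
  axiom : ∀ {c} → Mil⁻Axiom c → Mil⁻Rule [] c

data MilRule {A : Set} : List (Equation A) → Equation A → Set where
  mil⁻ : ∀ {ps c} → Mil⁻Rule ps c → MilRule ps c
  RSP⋆ : ∀ {e f g} → ¬ (f ↓) → MilRule (e ≐ f · e ⊕ g ∷ []) (e ≐ f ⋆ · g)

Mil⁻ Mil : ProofSystem A
Mil⁻ = record { Rule = Mil⁻Rule }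
Mil  = record { Rule = MilRule }

ELBased : ProofSystem A → Set
ELBased S = ∀ {ps c} → ELRule ps c → Rule S ps c

infix 4 ACI⊑_ _≾_

ACI⊑_ : ProofSystem A → Set
ACI⊑ S = ∀ {c} → ACIAxiom c → Rule S [] c

_≾_ : ProofSystem A → ProofSystem A → Set
S₁ ≾ S₂ = ∀ e f → e =[ S₁ ] f → e =[ S₂ ] f

------------------------------------------------------------------------
-- 1-charts

data Label (A : Set) : Set where
  proper : A → Label A
  one    : Label A

⟦_⟧ : Label A → StExp A
⟦ proper a ⟧ = act a
⟦ one ⟧      = 𝟏

-- The vertex set is Fin size.  Trans v a w is read as a mere proposition:
-- a transition is the triple (v , a , w), not a proof of Trans v a w.
record OneChart (A : Set) : Set₁ where
  field
    size  : ℕ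
    start : Fin size
    Trans : Fin size → Label A → Fin size → Set
    term  : Subset size

  Vertex : Set
  Vertex = Fin size

  Triples : Set₁
  Triples = Vertex → Label A → Vertex → Set

  WeaklyGuarded : Set
  WeaklyGuarded = ∀ v → ¬ TransClosure (λ x y → Trans x one y) v v

  τ : Vertex → StExp A
  τ v with v ∈? term
  ... | yes _ = 𝟏
  ... | no  _ = 𝟎

  ListsTransitionsFrom : Vertex → List (Label A × Vertex) → Set
  ListsTransitionsFrom v l = ∀ a w → (a , w) ∈ˡ l ⇔ Trans v a w

  IsSolution : ProofSystem A → (Vertex → StExp A) → Set
  IsSolution S s = ∀ v → ∃[ l ] ListsTransitionsFrom v l ×
    s v =[ S ] τ v ⊕ ∑ (map (λ (a , w) → ⟦ a ⟧ · s w) l)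

------------------------------------------------------------------------
-- Sub-1-charts of a 1-chart C, loop 1-charts, and loop elimination

module _ (C : OneChart A) where
  open OneChart C

  -- Immediate termination in a sub-1-chart is inherited from C: it is the
  -- restriction of `term` to the vertices of the sub-1-chart.
  record SubChart : Set₁ where
    field
      V     : Vertex → Set
      init  : Vertex
      init∈ : V init
      T     : Triples
      T-⊆   : ∀ {x a y} → T x a y → Trans x a y
      T-src : ∀ {x a y} → T x a y → V x
      T-tgt : ∀ {x a y} → T x a y → V y

  open SubChart

  whole : SubChart
  whole = record
    { V = λ _ → ⊤ ; init = start ; init∈ = tt ; T = Trans
    ; T-⊆ = λ t → t ; T-src = λ _ → tt ; T-tgt = λ _ → tt }

  record InfinitePath (D : SubChart) : Set where
    field
      at   : ℕ → Vertex
      step : ∀ i → ∃[ a ] T D (at i) a (at (suc i))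

  open InfinitePath

  record IsLoopChart (L : SubChart) : Set where
    field
      L1 : Σ (InfinitePath L) λ p → at p 0 ≡ init L
      L2 : (p : InfinitePath L) → at p 0 ≡ init L → ∃[ k ] at p (suc k) ≡ init L
      L3 : ∀ {v} → V L v → v ∈ term → v ≡ init L

  BodyVertex : SubChart → Vertex → Set
  BodyVertex L w = V L w × w ≢ init L

  -- The vertices reached on paths of D that start with a transition in U
  -- and continue until v is reached.
  data Reached (D : SubChart) (v : Vertex) (U : Triples) : Vertex → Set where
    enter    : ∀ {x a y} → U x a y → Reached D v U y
    continue : ∀ {x a y} → Reached D v U x → x ≢ v → T D x a y → Reached D v U y

  generated : (D : SubChart) (v : Vertex) (U : Triples) →
              (∀ {x a y} → U x a y → x ≡ v × T D x a y) → SubChart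
  generated D v U U-⊆ = record
    { V     = λ w → w ≡ v ⊎ Reached D v U w
    ; init  = v
    ; init∈ = inj₁ refl
    ; T     = λ x a y → U x a y ⊎ (Reached D v U x × x ≢ v × T D x a y)
    ; T-⊆   = λ { (inj₁ u)           → T-⊆ D (proj₂ (U-⊆ u))
                ; (inj₂ (_ , _ , t)) → T-⊆ D t }
    ; T-src = λ { (inj₁ u)           → inj₁ (proj₁ (U-⊆ u))
                ; (inj₂ (r , _ , _)) → inj₂ r }
    ; T-tgt = λ { (inj₁ u)           → inj₂ (enter u)
                ; (inj₂ (r , n , t)) → inj₂ (continue r n t) } }

  record LoopSubChart (D : SubChart) : Set₁ where
    field
      apex     : Vertex
      Entry    : Triples
      entry-⊆  : ∀ {x a y} → Entry x a y → x ≡ apex × T D x a y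
      nonempty : ∃[ x ] ∃[ a ] ∃[ y ] Entry x a y

    chart : SubChart
    chart = generated D apex Entry entry-⊆

    field
      isLoop : IsLoopChart chart

  open LoopSubChart

  record MultiStep (D : SubChart) : Set₁ where
    field
      extra : ℕ

    Index : Set
    Index = Fin (suc extra)

    field
      loop     : Index → LoopSubChart D
      disjoint : ∀ {i j} → i ≢ j → ∀ {x a y} →
                 Entry (loop i) x a y → ¬ Entry (loop j) x a y
      outside  : ∀ {i j} → i ≢ j → ¬ BodyVertex (chart (loop j)) (apex (loop i))

    Removed : Triples
    Removed x a y = ∃[ i ] Entry (loop i) x a y

    InSomeBody : Vertex → Set
    InSomeBody w = ∃[ i ] BodyVertex (chart (loop i)) w

  open MultiStep

  -- Everything not reachable from the start vertex after the removal of the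
  -- loop-entry transitions is discarded.
  eliminate : (D : SubChart) → MultiStep D → SubChart
  eliminate D ms = record
    { V     = Reach
    ; init  = init D
    ; init∈ = ε
    ; T     = λ x a y → Reach x × Kept x a y
    ; T-⊆   = λ { (_ , t , _) → T-⊆ D t }
    ; T-src = proj₁
    ; T-tgt = λ { {_} {a} (r , k) → r ◅◅ ((a , k) ◅ ε) } }
    where
    Kept : Triples
    Kept x a y = T D x a y × ¬ Removed ms x a y

    Reach : Vertex → Set
    Reach = Star (λ x y → ∃[ a ] Kept x a y) (init D)

  data Run : SubChart → SubChart → Set₁ where
    done : ∀ {D} → Run D D
    _then_ : ∀ {D E} (ms : MultiStep D) → Run (eliminate D ms) E → Run D E

  -- The multi-steps of a run are numbered from 0 here, while the marking
  -- labels start at 1, hence the shift in `Records` below.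
  RemovedAt : ∀ {D E} → Run D E → ℕ → Triples
  RemovedAt done        _       _ _ _ = ⊥
  RemovedAt (ms then r) zero    x a y = Removed ms x a y
  RemovedAt (ms then r) (suc k) x a y = RemovedAt r k x a y

  InBodyAt : ∀ {D E} → Run D E → ℕ → Vertex → Set
  InBodyAt done        _       _ = ⊥
  InBodyAt (ms then r) zero    w = InSomeBody ms w
  InBodyAt (ms then r) (suc k) w = InBodyAt r k w

  Layered : ∀ {D E} → Run D E → Set
  Layered r = ∀ {j k x a y} → j < k → RemovedAt r k x a y → ¬ InBodyAt r j x

  -- Labelings are total functions on triples; their values outside of the
  -- transitions of C are irrelevant.
  Labeling : Set
  Labeling = Vertex → Label A → Vertex → ℕ

  Records : ∀ {D E} → Labeling → Run D E → Set
  Records ℓ r = ∀ {x a y} → Trans x a y →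
                ∀ k → ℓ x a y ≡ suc k ⇔ RemovedAt r k x a y

  record IsLLEEWitness (ℓ : Labeling) : Set₁ where
    field
      {final}    : SubChart
      run        : Run whole final
      successful : ¬ InfinitePath final
      layered    : Layered run
      records    : Records ℓ run

  Guarded : Labeling → Set
  Guarded ℓ = ∀ {x a y} → Trans x a y → ℓ x a y ≢ 0 → ∃[ b ] a ≡ proper b

  GuardedLLEE : Set₁
  GuardedLLEE = ∃[ ℓ ] IsLLEEWitness ℓ × Guarded ℓ

------------------------------------------------------------------------
-- Coinductive proofs

record CoinductiveProof (S : ProofSystem A) (e₁ e₂ : StExp A) : Set₁ where
  field
    chart : OneChart A

  open OneChart chart

  field
    weaklyGuarded : WeaklyGuarded
    L             : Vertex → Equation A
    solutionˡ     : IsSolution S (lhs ∘ L)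
    solutionʳ     : IsSolution S (rhs ∘ L)
    conclusionˡ   : lhs (L start) ≡ e₁
    conclusionʳ   : rhs (L start) ≡ e₂

LLEEWitnessed : ∀ {S : ProofSystem A} {e₁ e₂} → CoinductiveProof S e₁ e₂ → Set₁
LLEEWitnessed P = GuardedLLEE (CoinductiveProof.chart P)

infix 4 _=LLEE[_]_

_=LLEE[_]_ : StExp A → ProofSystem A → StExp A → Set₁
e₁ =LLEE[ S ] e₂ = Σ (CoinductiveProof S e₁ e₂) LLEEWitnessed

{-# OPTIONS --safe #-}

-- Fix the chart, the run that its witness records, and a family of solutions s i.
-- Call X proportional to Y if there is one expression t with X i = t · Y i for all i.
-- By induction on the multi-step that removes it, a loop-entry transition from v to w
-- makes s _ w proportional to s _ v: a vertex w in the body of the loop does not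
-- terminate, its own loop-entry transitions were removed in earlier multi-steps, and
-- its other transitions stay in the loop, where the paths that avoid v have no cycle.
-- Hence s i w = f · s i w + g · s i v with f and g independent of i, and f does not
-- terminate since loop-entry transitions are proper, so that RSP⋆ applies.  The same
-- argument on the acyclic result of the run makes s _ start proportional to 𝟏.

module Submission where

open import Data.Bool using (Bool; true; false; if_then_else_)
open import Data.Fin using (Fin; _≟_)
open import Data.Fin.Induction using (spo-wellFounded)
open import Data.Fin.Subset using (_∉_)
open import Data.Fin.Subset.Properties using (_∈?_)
open import Data.List using (List; []; _∷_; foldl; foldr; map)
open import Data.List.Membership.Propositional using () renaming (_∈_ to _∈ˡ_)
open import Data.List.Relation.Binary.Subset.Propositional using (_⊆_)
open import Data.List.Relation.Binary.Subset.Propositional.Properties using (map⁺)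
open import Data.List.Relation.Unary.All using ([]; _∷_)
open import Data.List.Relation.Unary.Any using (here; there)
open import Data.Nat using (ℕ; zero; suc; _<_)
open import Data.Nat.Induction using (<-rec)
open import Data.Nat.Properties using (<-cmp)
open import Data.Product using (∃-syntax; _×_; _,_; proj₁; proj₂)
open import Data.Sum using (_⊎_; inj₁; inj₂)
open import Function using (_∘_; id)
open import Function.Bundles using (module Equivalence)
open import Induction.WellFounded using (Acc; acc; WellFounded)
open import Relation.Binary.Bundles using (Setoid)
open import Relation.Binary.Construct.Closure.ReflexiveTransitive using (Star; ε; _◅_)
open import Relation.Binary.Construct.Closure.Transitive
  using (TransClosure; _∷_; _++_) renaming ([_] to [_]⁺)
open import Relation.Binary.Definitions using (tri<; tri≈; tri>)
open import Relation.Binary.PropositionalEquality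
  using (_≡_; _≢_; refl; sym; trans; subst; isEquivalence; resp₂)
import Relation.Binary.Reasoning.Setoid as SetoidReasoning
open import Relation.Nullary using (¬_; yes; no; contradiction)

open import Defs

open Equivalence using (to; from)

-- Infinite paths from cycles

module _ {X : Set} {R : X → X → Set} where

  -- A state is a vertex with the rest of the cycle back to `x`; after its last edge the whole cycle
  -- is taken again.
  cycle⇒path : ∀ {x} → TransClosure R x x →
               ∃[ p ] p 0 ≡ x × (∀ i → R (p i) (p (suc i)))
  cycle⇒path {x} c = proj₁ ∘ state , refl , λ i → next-step (state i)
    where
    State : Set
    State = ∃[ y ] TransClosure R y x

    next : State → State
    next (_ , [ _ ]⁺)   = x , c
    next (_ , (_ ∷ w)) = _ , w

    next-step : ∀ q → R (proj₁ q) (proj₁ (next q))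
    next-step (_ , [ r ]⁺)   = r
    next-step (_ , (r ∷ _)) = r

    state : ℕ → State
    state zero    = x , c
    state (suc i) = next (state i)

-- The closure of an acyclic relation is a strict partial order on a finite set. It is reversed, so
-- that recursion follows the edges forward.
acyclic⇒wellFounded : ∀ {n} {R : Fin n → Fin n → Set} →
                      (∀ {x} → ¬ TransClosure R x x) →
                      WellFounded (λ x y → TransClosure R y x)
acyclic⇒wellFounded acyclic = spo-wellFounded {_≈_ = _≡_} record
  { isEquivalence = isEquivalence
  ; irrefl        = λ { refl → acyclic }
  ; trans         = λ p q → q ++ p
  ; <-resp-≈      = resp₂ _
  }

-- Equational reasoning in Mil

module _ {A : Set} where

  infix 4 _≈_

  _≈_ : StExp A → StExp A → Set
  e ≈ f = e =[ Mil ] f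

  ≈-refl : ∀ {e} → e ≈ e
  ≈-refl = apply (mil⁻ (el reflexivity)) []

  ≈-sym : ∀ {e f} → e ≈ f → f ≈ e
  ≈-sym p = apply (mil⁻ (el symmetry)) (p ∷ [])

  ≈-trans : ∀ {e f g} → e ≈ f → f ≈ g → e ≈ g
  ≈-trans p q = apply (mil⁻ (el transitivity)) (p ∷ q ∷ [])

  ≈-setoid : Setoid _ _
  ≈-setoid = record
    { Carrier       = StExp A
    ; _≈_           = _≈_
    ; isEquivalence = record { refl = ≈-refl ; sym = ≈-sym ; trans = ≈-trans }
    }

  open SetoidReasoning ≈-setoid

  ax : ∀ {e f} → Mil⁻Axiom (e ≐ f) → e ≈ f
  ax a = apply (mil⁻ (axiom a)) []

  ≈-context : ∀ {e f} (C : Context A) → e ≈ f → C [ e ] ≈ C [ f ]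
  ≈-context C p = apply (mil⁻ (el (context C))) (p ∷ [])

  ⊕-congˡ : ∀ {e f g} → f ≈ g → e ⊕ f ≈ e ⊕ g
  ⊕-congˡ {e} = ≈-context (e ⊕ʳ □)

  ⊕-congʳ : ∀ {e f g} → f ≈ g → f ⊕ e ≈ g ⊕ e
  ⊕-congʳ {e} = ≈-context (□ ⊕ˡ e)

  ⊕-cong : ∀ {e f g h} → e ≈ f → g ≈ h → e ⊕ g ≈ f ⊕ h
  ⊕-cong p q = ≈-trans (⊕-congʳ p) (⊕-congˡ q)

  ·-congˡ : ∀ {e f g} → f ≈ g → e · f ≈ e · g
  ·-congˡ {e} = ≈-context (e ·ʳ □)

  ⊕-assoc : ∀ e f g → (e ⊕ f) ⊕ g ≈ e ⊕ (f ⊕ g)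
  ⊕-assoc e f g = ax (aci (assoc⊕ e f g))

  ⊕-comm : ∀ e f → e ⊕ f ≈ f ⊕ e
  ⊕-comm e f = ax (aci (comm⊕ e f))

  ⊕-idem : ∀ e → e ⊕ e ≈ e
  ⊕-idem e = ax (aci (idem⊕ e))

  ⊕-identityʳ : ∀ e → e ⊕ 𝟎 ≈ e
  ⊕-identityʳ e = ax (neutral⊕ e)

  ⊕-identityˡ : ∀ e → 𝟎 ⊕ e ≈ e
  ⊕-identityˡ e = ≈-trans (⊕-comm 𝟎 e) (⊕-identityʳ e)

  ⊕-left-comm : ∀ e f g → e ⊕ (f ⊕ g) ≈ f ⊕ (e ⊕ g)
  ⊕-left-comm e f g = begin
    e ⊕ (f ⊕ g)  ≈⟨ ⊕-assoc e f g ⟨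
    (e ⊕ f) ⊕ g  ≈⟨ ⊕-congʳ (⊕-comm e f) ⟩
    (f ⊕ e) ⊕ g  ≈⟨ ⊕-assoc f e g ⟩
    f ⊕ (e ⊕ g)  ∎

  sum : List (StExp A) → StExp A
  sum = foldr _⊕_ 𝟎

  ∑≈sum : ∀ es → ∑ es ≈ sum es
  ∑≈sum []       = ≈-refl
  ∑≈sum (e ∷ es) = foldl≈ e es
    where
    foldl≈ : ∀ d fs → foldl _⊕_ d fs ≈ d ⊕ sum fs
    foldl≈ d []       = ≈-sym (⊕-identityʳ d)
    foldl≈ d (f ∷ fs) = ≈-trans (foldl≈ (d ⊕ f) fs) (⊕-assoc d f (sum fs))

  sum-absorbs : ∀ {e fs} → e ∈ˡ fs → e ⊕ sum fs ≈ sum fs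
  sum-absorbs {e} {f ∷ fs} (here refl) = begin
    e ⊕ (e ⊕ sum fs)  ≈⟨ ⊕-assoc e e (sum fs) ⟨
    (e ⊕ e) ⊕ sum fs  ≈⟨ ⊕-congʳ (⊕-idem e) ⟩
    e ⊕ sum fs        ∎
  sum-absorbs {e} {f ∷ fs} (there e∈fs) = begin
    e ⊕ (f ⊕ sum fs)  ≈⟨ ⊕-left-comm e f (sum fs) ⟩
    f ⊕ (e ⊕ sum fs)  ≈⟨ ⊕-congˡ (sum-absorbs e∈fs) ⟩
    f ⊕ sum fs        ∎

  sum-⊆ : ∀ {es fs} → es ⊆ fs → sum es ⊕ sum fs ≈ sum fs
  sum-⊆ {[]}     {fs} _     = ⊕-identityˡ (sum fs)
  sum-⊆ {e ∷ es} {fs} es⊆fs = begin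
    (e ⊕ sum es) ⊕ sum fs  ≈⟨ ⊕-assoc e (sum es) (sum fs) ⟩
    e ⊕ (sum es ⊕ sum fs)  ≈⟨ ⊕-congˡ (sum-⊆ (es⊆fs ∘ there)) ⟩
    e ⊕ sum fs             ≈⟨ sum-absorbs (es⊆fs (here refl)) ⟩
    sum fs                 ∎

  -- Two lists of the transitions from a vertex may differ in order and multiplicity, which
  -- associativity, commutativity and idempotence absorb.
  sum-cong-⊆ : ∀ {es fs} → es ⊆ fs → fs ⊆ es → sum es ≈ sum fs
  sum-cong-⊆ {es} {fs} es⊆fs fs⊆es = begin
    sum es           ≈⟨ sum-⊆ fs⊆es ⟨
    sum fs ⊕ sum es  ≈⟨ ⊕-comm (sum fs) (sum es) ⟩
    sum es ⊕ sum fs  ≈⟨ sum-⊆ es⊆fs ⟩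
    sum fs           ∎

  ⋆-unique : ∀ {e f g x} → ¬ f ↓ → e ≈ f · e ⊕ g · x → e ≈ (f ⋆ · g) · x
  ⋆-unique {e} {f} {g} {x} ¬f↓ p =
    ≈-trans (apply (RSP⋆ ¬f↓) (p ∷ [])) (≈-sym (ax (assoc· (f ⋆) g x)))

-- Proportional families of expressions

module _ {A I : Set} where

  open SetoidReasoning (≈-setoid {A})

  infix 4 _∝_

  -- As `t` is chosen before `i`, all members of a family proportional to the constant `𝟏` are
  -- provably equal.
  _∝_ : (X Y : I → StExp A) → Set
  X ∝ Y = ∃[ t ] ∀ i → X i ≈ t · Y i

  ∝-refl : ∀ {X} → X ∝ X
  ∝-refl = 𝟏 , λ i → ≈-sym (ax (idˡ· _))

  𝟎∝ : ∀ {X} → (λ _ → 𝟎) ∝ X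
  𝟎∝ = 𝟎 , λ i → ≈-sym (ax (zeroˡ _))

  const∝𝟏 : ∀ e → (λ _ → e) ∝ (λ _ → 𝟏)
  const∝𝟏 e = e , λ i → ≈-sym (ax (idʳ· e))

  module _ {V : Set} (s : I → V → StExp A) where

    summands : List (Label A × V) → I → List (StExp A)
    summands l i = map (λ (a , u) → ⟦ a ⟧ · s i u) l

    module _ (X Y : I → StExp A) where

      Splits : Label A × V → Set
      Splits (a , u) = (∃[ b ] a ≡ proper b) × ((λ i → s i u) ∝ X)
                     ⊎ ((λ i → s i u) ∝ Y)

      -- The coefficient `f` collects only terms `act b · t`, none of which terminates; everything
      -- else goes into `g`.
      sum-splits : ∀ l → (∀ {p} → p ∈ˡ l → Splits p) →
                   ∃[ f ] ∃[ g ] (¬ f ↓) ×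
                   (∀ i → sum (summands l i) ≈ f · X i ⊕ g · Y i)
      sum-splits [] _ = 𝟎 , 𝟎 , (λ ()) , λ i → begin
        𝟎                    ≈⟨ ⊕-idem 𝟎 ⟨
        𝟎 ⊕ 𝟎                ≈⟨ ⊕-cong (ax (zeroˡ _)) (ax (zeroˡ _)) ⟨
        𝟎 · X i ⊕ 𝟎 · Y i    ∎
      sum-splits ((a , u) ∷ l) split
        with sum-splits l (split ∘ there) | split (here refl)
      ... | f , g , ¬f↓ , eq | inj₁ ((b , refl) , t , teq) =
        act b · t ⊕ f , g
        , (λ { (⊕↓ˡ (·↓ () _)) ; (⊕↓ʳ f↓) → ¬f↓ f↓ })
        , λ i → begin
          act b · s i u ⊕ sum (summands l i)
            ≈⟨ ⊕-cong (·-congˡ (teq i)) (eq i) ⟩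
          act b · (t · X i) ⊕ (f · X i ⊕ g · Y i)
            ≈⟨ ⊕-congʳ (ax (assoc· (act b) t (X i))) ⟨
          (act b · t) · X i ⊕ (f · X i ⊕ g · Y i)
            ≈⟨ ⊕-assoc _ _ _ ⟨
          ((act b · t) · X i ⊕ f · X i) ⊕ g · Y i
            ≈⟨ ⊕-congʳ (ax (distribʳ _ _ _)) ⟨
          (act b · t ⊕ f) · X i ⊕ g · Y i  ∎
      ... | f , g , ¬f↓ , eq | inj₂ (t , teq) =
        f , ⟦ a ⟧ · t ⊕ g , ¬f↓ , λ i → begin
          ⟦ a ⟧ · s i u ⊕ sum (summands l i)
            ≈⟨ ⊕-cong (·-congˡ (teq i)) (eq i) ⟩
          ⟦ a ⟧ · (t · Y i) ⊕ (f · X i ⊕ g · Y i)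
            ≈⟨ ⊕-congʳ (ax (assoc· ⟦ a ⟧ t (Y i))) ⟨
          (⟦ a ⟧ · t) · Y i ⊕ (f · X i ⊕ g · Y i)
            ≈⟨ ⊕-left-comm _ _ _ ⟩
          f · X i ⊕ ((⟦ a ⟧ · t) · Y i ⊕ g · Y i)
            ≈⟨ ⊕-congˡ (ax (distribʳ _ _ _)) ⟨
          f · X i ⊕ (⟦ a ⟧ · t ⊕ g) · Y i  ∎

      solve-∝ : ∀ {e} l → (∀ {p} → p ∈ˡ l → Splits p) → (λ _ → e) ∝ Y →
                (∀ i → X i ≈ e ⊕ sum (summands l i)) → X ∝ Y
      solve-∝ {e} l split (h , heq) eqs
        with f , g , ¬f↓ , eq ← sum-splits l split =
        f ⋆ · (h ⊕ g) , λ i → ⋆-unique ¬f↓ (begin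
          X i                              ≈⟨ eqs i ⟩
          e ⊕ sum (summands l i)           ≈⟨ ⊕-cong (heq i) (eq i) ⟩
          h · Y i ⊕ (f · X i ⊕ g · Y i)    ≈⟨ ⊕-left-comm _ _ _ ⟩
          f · X i ⊕ (h · Y i ⊕ g · Y i)    ≈⟨ ⊕-congˡ (ax (distribʳ _ _ _)) ⟨
          f · X i ⊕ (h ⊕ g) · Y i          ∎)

-- Acyclicity of loop bodies, and the stages of a run

module _ {A : Set} (C : OneChart A) where

  open OneChart C
  open SubChart
  open InfinitePath

  τ≡𝟎 : ∀ {v} → v ∉ term → τ v ≡ 𝟎
  τ≡𝟎 {v} v∉ with v ∈? term
  ... | yes v∈ = contradiction v∈ v∉
  ... | no  _  = refl

  -- Only the source has to differ from `v`. On a cycle every vertex is a source, so cycles of such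
  -- steps avoid `v`.
  InternalStep : (D : SubChart C) (v : Vertex) (U : Triples) → Vertex → Vertex → Set
  InternalStep D v U x y =
    Reached C D v U x × x ≢ v × ∃[ a ] T D x a y

  module _ {D : SubChart C} (L : LoopSubChart C D) where

    open LoopSubChart L
    open IsLoopChart isLoop

    private
      v = apex
      Body = Reached C D apex Entry

    -- `L2` speaks only of paths from the apex, so a path in the body is prolonged backwards along
    -- the derivation of `Body w`.
    unfoldToApex : ∀ {w} → Body w → (p : InfinitePath C chart) → at p 0 ≡ w →
                   (∀ i → at p i ≢ v) →
                   ∃[ q ] at {C = C} {D = chart} q 0 ≡ v × (∀ i → at q (suc i) ≢ v)
    unfoldToApex (enter {a = a} u) p refl p≢v
      with refl , _ ← entry-⊆ u =
      record
        { at   = λ { zero → v ; (suc i) → at p i }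
        ; step = λ { zero → a , inj₁ u ; (suc i) → step p i } }
      , refl , p≢v
    unfoldToApex (continue {x} {a} r x≢v t) p refl p≢v =
      unfoldToApex r
        (record
          { at   = λ { zero → x ; (suc i) → at p i }
          ; step = λ { zero → a , inj₂ (r , x≢v , t) ; (suc i) → step p i } })
        refl
        λ { zero → x≢v ; (suc i) → p≢v i }

    -- Running around a cycle forever, after an approach from the apex, would never return to the
    -- apex, against `L2`.
    body-acyclic : ∀ {w} → ¬ TransClosure (InternalStep D apex Entry) w w
    body-acyclic c
      with p , refl , R ← cycle⇒path c
      with q , q0≡v , q≢v ← unfoldToApex (proj₁ (R 0))
             (record { at = p
                     ; step = λ i → let r , n , a , t = R i in a , inj₂ (r , n , t) })
             refl (λ i → proj₁ (proj₂ (R i)))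
      with k , qk≡v ← L2 q q0≡v = q≢v k qk≡v

  final-acyclic : ∀ {D} → ¬ InfinitePath C D →
                  ∀ {w} → ¬ TransClosure (λ x y → ∃[ a ] T D x a y) w w
  final-acyclic ¬path c with p , _ , R ← cycle⇒path c =
    ¬path (record { at = p ; step = R })

  module _ (ℓ : Labeling C) where

    -- An invariant of the run: a multi-step removes transitions with positive label and then
    -- unreachable vertices, so each surviving vertex keeps its body transitions.
    BodyClosed : SubChart C → Set
    BodyClosed D = ∀ {x a y} → V D x → Trans x a y → ℓ x a y ≡ 0 → T D x a y

    -- A consequence of `Records` that passes to the rest of a run by shifting `k`, whereas the
    -- labels in `Records` are tied to the numbering of the whole run.
    Unremoved : ∀ {D E} → Run C D E → Set
    Unremoved r = ∀ k {x a y} → Trans x a y → ℓ x a y ≡ 0 → ¬ RemovedAt C r k x a y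

    records⇒unremoved : ∀ {D E} (r : Run C D E) → Records C ℓ r → Unremoved r
    records⇒unremoved r rec k {x} {a} {y} t ℓ≡0 rem
      with () ← trans (sym (from (rec t k) rem)) ℓ≡0

    eliminate-closed : ∀ {D} (ms : MultiStep C D) → BodyClosed D →
                       (∀ {x a y} → Trans x a y → ℓ x a y ≡ 0 →
                        ¬ MultiStep.Removed ms x a y) →
                       BodyClosed (eliminate C D ms)
    eliminate-closed {D} ms closed unrem r t ℓ≡0 =
      r , closed (inside (init∈ D) r) t ℓ≡0 , unrem t ℓ≡0
      where
      inside : ∀ {x y} → V D x →
               Star (λ x y → ∃[ a ] T D x a y × ¬ MultiStep.Removed ms x a y) x y →
               V D y
      inside v ε                    = v
      inside v ((_ , t , _) ◅ rest) = inside (T-tgt D t) rest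

    record Stage {D E} (r : Run C D E) (k : ℕ) : Set₁ where
      field
        {source} : SubChart C
        ms       : MultiStep C source
        closed   : BodyClosed source
        removed  : ∀ {x a y} → RemovedAt C r k x a y → MultiStep.Removed ms x a y
        inBody   : ∀ {w} → MultiStep.InSomeBody ms w → InBodyAt C r k w

    -- A transition removed at `k` ensures that the run has such a step, since `done` removes none.
    stage : ∀ {D E} (r : Run C D E) → BodyClosed D → Unremoved r →
            ∀ k {x a y} → RemovedAt C r k x a y → Stage r k
    stage (ms then r) closed unrem zero    _   = record
      { ms = ms ; closed = closed ; removed = id ; inBody = id }
    stage (ms then r) closed unrem (suc k) rem = record { Stage st }
      where
      st = stage r (eliminate-closed ms closed (unrem 0)) (unrem ∘ suc) k rem

    final-closed : ∀ {D E} (r : Run C D E) → BodyClosed D → Unremoved r → BodyClosed E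
    final-closed done        closed unrem = closed
    final-closed (ms then r) closed unrem =
      final-closed r (eliminate-closed ms closed (unrem 0)) (unrem ∘ suc)

  -- Uniqueness of solutions

  module _ {I : Set} (s : I → Vertex → StExp A) where

    -- One list serves all `i`, which makes the coefficients read off from it independent of `i`.
    CommonSolution : Set
    CommonSolution = ∀ v → ∃[ l ] ListsTransitionsFrom v l ×
      (∀ i → s i v ≈ τ v ⊕ sum (summands s l i))

    module _ (solution : CommonSolution) {ℓ : Labeling C}
             (witness : IsLLEEWitness C ℓ) (guarded : Guarded C ℓ) where

      open IsLLEEWitness witness

      private
        sol : Vertex → I → StExp A
        sol v i = s i v

        unremoved : Unremoved ℓ run
        unremoved = records⇒unremoved ℓ run records

      -- Loop-entry transitions are proper by guardedness and feed the coefficient of `sol w`; body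
      -- transitions and termination feed that of `Y`.
      vertex-∝ : ∀ {w Y} → (λ _ → τ w) ∝ Y →
                 (∀ {a u} → Trans w a u → ℓ w a u ≡ 0 → sol u ∝ Y) →
                 (∀ {k a u} → RemovedAt C run k w a u → sol u ∝ sol w) →
                 sol w ∝ Y
      vertex-∝ {w} {Y} τ∝ body entry
        with l , lists , eqs ← solution w =
        solve-∝ s (sol w) Y l (λ {p} p∈l → split (to (lists _ _) p∈l)) τ∝ eqs
        where
        split : ∀ {a u} → Trans w a u → Splits s (sol w) Y (a , u)
        split {a} {u} t with ℓ w a u in eq
        ... | zero  = inj₂ (body t eq)
        ... | suc k = inj₁ (guarded t ℓ≢0 , entry (to (records t k) eq))
          where
          ℓ≢0 : ℓ w a u ≢ 0
          ℓ≢0 p with () ← trans (sym eq) p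

      Entries∝ : ℕ → Set
      Entries∝ k = ∀ {v a w} → RemovedAt C run k v a w → sol w ∝ sol v

      module _ {k} (st : Stage ℓ run k) (i : MultiStep.Index (Stage.ms st))
               (ih : ∀ {j} → j < k → Entries∝ j) where

        open Stage st
        open MultiStep ms
        open LoopSubChart (loop i)
        open IsLoopChart isLoop

        private
          Body : Vertex → Set
          Body = Reached C source apex Entry

        body⊆source : ∀ {w} → Body w → V source w
        body⊆source (enter e)        = T-tgt source (proj₂ (entry-⊆ e))
        body⊆source (continue _ _ t) = T-tgt source t

        body-∝ : ∀ {w} → Body w → sol w ∝ sol apex
        body-∝ r = go r (acyclic⇒wellFounded (body-acyclic (loop i)) _)
          where
          go : ∀ {w} → Body w →
               Acc (λ x y → TransClosure (InternalStep source apex Entry) y x) w →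
               sol w ∝ sol apex
          go {w} r (acc rs) with w ≟ apex
          ... | yes refl = ∝-refl
          ... | no w≢ = vertex-∝ τ∝ step-∝ inner-∝
            where
            -- By `L3` only the apex may terminate, so `τ w` is `𝟎`.
            τ∝ : (λ _ → τ w) ∝ sol apex
            τ∝ = subst (λ e → (λ _ → e) ∝ sol apex)
                   (sym (τ≡𝟎 λ w∈ → w≢ (L3 (inj₂ r) w∈))) 𝟎∝

            step-∝ : ∀ {a u} → Trans w a u → ℓ w a u ≡ 0 → sol u ∝ sol apex
            step-∝ t ℓ≡0 = go (continue r w≢ t′) (rs [ r , w≢ , _ , t′ ]⁺)
              where t′ = closed (body⊆source r) t ℓ≡0

            inner-∝ : ∀ {j a u} → RemovedAt C run j w a u → sol u ∝ sol w
            inner-∝ {j} rem with <-cmp j k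
            ... | tri< j<k _ _ = ih j<k rem
            -- `w` lies in a body eliminated at `k`, so layeredness forbids removing its loop-entry
            -- transitions later.
            ... | tri> _ _ k<j =
              contradiction (inBody (i , inj₂ r , w≢)) (layered k<j rem)
            -- In the same multi-step `w` would be the apex of a loop: of this one, against `w≢`, or
            -- of another one while in the body of this one, against `outside`.
            ... | tri≈ _ refl _ with i′ , e ← removed rem
              with refl , _ ← LoopSubChart.entry-⊆ (loop i′) e | i′ ≟ i
            ... | yes refl = contradiction refl w≢
            ... | no i′≢i  = contradiction (inj₂ r , w≢) (outside i′≢i)

        loop-entry-∝ : ∀ {v a w} → Entry v a w → sol w ∝ sol v
        loop-entry-∝ e with refl , _ ← entry-⊆ e = body-∝ (enter e)

      entry-∝ : ∀ k → Entries∝ k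
      entry-∝ = <-rec Entries∝ λ k ih {_} {_} {_} rem →
        let st    = stage ℓ run (λ _ t _ → t) unremoved k rem
            i , e = Stage.removed st rem
        in loop-entry-∝ st i ih e

      -- A successful run ends in a chart without cycles that keeps the body transitions of its
      -- vertices; `entry-∝` handles the removed ones.
      final-∝ : ∀ {w} → V final w → sol w ∝ (λ _ → 𝟏)
      final-∝ v = go v (acyclic⇒wellFounded (final-acyclic successful) _)
        where
        go : ∀ {w} → V final w →
             Acc (λ x y → TransClosure (λ x y → ∃[ a ] T final x a y) y x) w →
             sol w ∝ (λ _ → 𝟏)
        go {w} v (acc rs) = vertex-∝ (const∝𝟏 (τ w)) step-∝ (entry-∝ _)
          where
          step-∝ : ∀ {a u} → Trans w a u → ℓ w a u ≡ 0 → sol u ∝ (λ _ → 𝟏)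
          step-∝ t ℓ≡0 = go (T-tgt final t′) (rs [ _ , t′ ]⁺)
            where t′ = final-closed ℓ run (λ _ t _ → t) unremoved v t ℓ≡0

      start-∝ : sol start ∝ (λ _ → 𝟏)
      start-∝ = subst (λ v → sol v ∝ (λ _ → 𝟏)) (run-init run) (final-∝ (init∈ final))
        where
        run-init : ∀ {D E} → Run C D E → init E ≡ init D
        run-init done        = refl
        run-init (ms then r) = run-init r

  -- The list of the solution at `true` is imposed on both, as both lists enumerate the same
  -- transitions.
  commonSolution : ∀ {S} → S ≾ Mil → {s : Bool → Vertex → StExp A} →
                   (∀ b → IsSolution S (s b)) → CommonSolution s
  commonSolution S≾Mil {s} sols v
    with l , lists , _ ← sols true v = l , lists , eqs
    where
    eqs : ∀ b → s b v ≈ τ v ⊕ sum (summands s l b)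
    eqs b with m , lists′ , p ← sols b v =
      ≈-trans (S≾Mil _ _ p) (⊕-congˡ (≈-trans (∑≈sum (summands s m b))
        (sum-cong-⊆
          (map⁺ _ λ {x} x∈ → from (lists _ _) (to (lists′ _ _) x∈))
          (map⁺ _ λ {x} x∈ → from (lists′ _ _) (to (lists _ _) x∈)))))

proposition6p8 : (A : Set) (S : ProofSystem A) →
    ELBased S → ACI⊑ S → S ≾ Mil →
    (e₁ e₂ : StExp A) → e₁ =LLEE[ S ] e₂ → e₁ =[ Mil ] e₂
proposition6p8 A S _ _ S≾Mil e₁ e₂ (P , ℓ , witness , guarded) =
  subst (_≈ e₂) conclusionˡ (subst (lhs (L start) ≈_) conclusionʳ equal)
  where
  open CoinductiveProof P
  open OneChart chart

  s : Bool → Vertex → StExp A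
  s b = if b then lhs ∘ L else rhs ∘ L

  solutions : ∀ b → IsSolution S (s b)
  solutions true  = solutionˡ
  solutions false = solutionʳ

  equal : lhs (L start) ≈ rhs (L start)
  equal with t , eq ← start-∝ chart s (commonSolution chart S≾Mil solutions)
                        witness guarded =
    ≈-trans (eq true) (≈-sym (eq false))
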